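{- Let $A$ be a point or vector configuration of rank $r$ and let $T$ index a non-empty partial triangulation of $A$. If $T$ is right-extendable, then for each $f\in\mathrm{free}(T)$ there is a multi-covering set of simplex indices $C(f)\subseteq\mathrm{adm}(T)$ (the $f$-covering simplices) such that (i) for each $f\in\mathrm{free}(T)$ there is an $s_f\in C(f)$ that, for all $f'\in\mathrm{free}(T)$, is identical to or intersects properly with at least one $s_{f'}\in C(f')$; (ii) for all $f\in\mathrm{free}(T)$ and all $s_f\in C(f)$ one has $f\in\mathrm{intfacets}(s_f)$.
   Context: $A\in\mathbb{R}^{r\times n}$ has rank $r$ and columns $a_1,\dots,a_n$ (points in homogeneous coordinates, or vectors). A circuit is an inclusion-minimal linearly dependent set $C$ of column indices; a circuit signature splits $C=C_+\cup C_-$ such that $\sum_{i\in C_+}\lambda_ia_i=\sum_{i\in C_- }\lambda_ia_i$ for some $\lambda_i>0$, and $(C_+,C_-)$ is a signed circuit (each circuit yields two opposite ones). A cocircuit is an inclusion-maximal index set $C_0^*$ with $\operatorname{rank}(A_{C_0^*})<r$; with a non-zero $c\in\mathbb{R}^r$ satisfying $c^\top a_i=0$ exactly for $i\in C_0^*$ put $C_\pm^*=\{i:\pm c^\top a_i>0\}$. A simplex is an index set $S$ of size $r$ with $\operatorname{rank}(A_S)=r$; its facets are its $(r-1)$-subsets. Two simplices $S_1,S_2$ intersect properly if there is no signed circuit with $C_+\subseteq S_1$ and $C_-\subseteq S_2$. A simplex facet $F$ is interior if there is a cocircuit $C_0^*\supseteq F$ with $C_+^*$ and $C_-^*$ both non-empty.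 A triangulation is a non-empty set $\mathcal{T}$ of pairwise properly intersecting (feasible) simplices that is covering: for each interior facet $F$ of some $S\in\mathcal{T}$ there is another $S'\in\mathcal{T}$ containing $F$. A partial triangulation is a set of pairwise properly intersecting (feasible) simplices. (The set of feasible simplices, the ones considered in the enumeration, may be all simplices or a restricted set depending on the enumeration task.) Lexicographic order on sets of integers: $\emptyset\prec S$ for $S\ne\emptyset$; for non-empty $S,R$: $S\prec R$ iff $\min S<\min R$, or the minima agree and $S\setminus\{\min S\}\prec R\setminus\{\min R\}$. The $N$ feasible simplices are numbered $1,\dots,N$ in increasing lexicographic order, and the $M$ interior simplex facets are numbered $1,\dots,M$ in increasing lexicographic order; simplices and facets are identified with their numbers, and $T\subseteq\{1,\dots,N\}$ indexes the corresponding set of simplices. For $s\in\{1,\dots,N\}$, $\mathrm{intfacets}(s)\subseteq\{1,\dots,M\}$ is the set of (numbers of) interior facets of simplex $s$. For $T$ indexing a partial triangulation, $\mathrm{adm}(T)$ is the set of all $s\in\{1,\dots,N\}$ such that for all $s'\in T$: $s>s'$ and simplex $s$ intersects simplex $s'$ properly; $\mathrm{free}(T)$ is the set of $f\in\{1,\dots,M\}$ with $f\in\mathrm{intfacets}(s)$ for exactly one $s\in T$. $T$ is right-extendable if there is a $T'\supseteq T$ indexing a triangulation such that every element of $T'\setminus T$ is larger than every element of $T$. -}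

module Defs where

open import Data.Bool.Base using (if_then_else_)
open import Data.Fin.Base as Fin using (Fin)
open import Data.Fin.Subset
  using (Subset; _∈_; _∉_; _⊆_; _∪_; _∩_; _-_; ⊤; ⊥; ∣_∣; Nonempty; Empty)
open import Data.Nat.Base as ℕ using (ℕ; suc)
import Data.Nat.Properties as ℕ
open import Data.Product using (∃!)
open import Data.Product.Base using (∃-syntax; _×_; _,_)
open import Data.Rational.Base as ℚ using (ℚ; 0ℚ; 1ℚ; ½; Positive)
import Data.Rational.Properties as ℚ
open import Data.Rational.Solver using (module +-*-Solver)
open import Data.Vec.Base using (lookup)
open import Data.Vec.Functional using (Vector; foldr)
open import Function.Bundles using (_⇔_)
open import Level using (0ℓ)
open import Relation.Binary.PropositionalEquality
  using (_≡_; _≢_; refl; sym; cong; subst)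
open import Relation.Nullary.Negation using (¬_)
import Relation.Unary as U
open U using (Pred)

-- Cauchy reals: a real is a Cauchy sequence of rationals, and equality of
-- reals is _≈_ rather than _≡_.

Cauchy : (ℕ → ℚ) → Set
Cauchy x = ∀ ε → .{{Positive ε}} → ∃[ K ] ∀ m n → K ℕ.≤ m → K ℕ.≤ n →
           ℚ.∣ x m ℚ.- x n ∣ ℚ.< ε

record ℝ : Set where
  constructor mkℝ
  field
    seq    : ℕ → ℚ
    cauchy : Cauchy seq

open ℝ public

infix 4 _≈_ _≉_ _<_ _>_

_≈_ : ℝ → ℝ → Set
x ≈ y = ∀ ε → .{{Positive ε}} → ∃[ K ] ∀ n → K ℕ.≤ n →
        ℚ.∣ seq x n ℚ.- seq y n ∣ ℚ.< ε

_≉_ : ℝ → ℝ → Set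
x ≉ y = ¬ (x ≈ y)

_<_ : ℝ → ℝ → Set
x < y = ∃[ ε ] Positive ε × ∃[ K ] ∀ n → K ℕ.≤ n → seq x n ℚ.+ ε ℚ.< seq y n

_>_ : ℝ → ℝ → Set
x > y = y < x

private
  half+half : ∀ ε → ½ ℚ.* ε ℚ.+ ½ ℚ.* ε ≡ ε
  half+half = solve 1 (λ ε → con ½ :* ε :+ con ½ :* ε := ε) refl
    where open +-*-Solver

  half-pos : ∀ ε → .{{Positive ε}} → Positive (½ ℚ.* ε)
  half-pos ε = ℚ.pos*pos⇒pos ½ ε

  +-rearrange : ∀ a b c d → (a ℚ.+ b) ℚ.- (c ℚ.+ d) ≡ (a ℚ.- c) ℚ.+ (b ℚ.- d)
  +-rearrange = solve 4 (λ a b c d →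
      (a :+ b) :- (c :+ d) := (a :- c) :+ (b :- d)) refl
    where open +-*-Solver

  *-rearrange : ∀ a b c d → (a ℚ.* b) ℚ.- (c ℚ.* d) ≡
                a ℚ.* (b ℚ.- d) ℚ.+ d ℚ.* (a ℚ.- c)
  *-rearrange = solve 4 (λ a b c d →
      (a :* b) :- (c :* d) := a :* (b :- d) :+ d :* (a :- c)) refl
    where open +-*-Solver

  bounded : ∀ {x} → Cauchy x → ∃[ B ] Positive B × ∃[ K ] ∀ n → K ℕ.≤ n →
            ℚ.∣ x n ∣ ℚ.≤ B
  bounded {x} cx with cx 1ℚ
  ... | K , p = 1ℚ ℚ.+ ℚ.∣ x K ∣
              , ℚ.positive (ℚ.+-mono-<-≤ (ℚ.positive⁻¹ 1ℚ) (ℚ.0≤∣p∣ (x K)))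
              , K , λ n le → begin
    ℚ.∣ x n ∣                           ≡⟨ cong ℚ.∣_∣ (split (x n) (x K)) ⟩
    ℚ.∣ (x n ℚ.- x K) ℚ.+ x K ∣         ≤⟨ ℚ.∣p+q∣≤∣p∣+∣q∣ (x n ℚ.- x K) (x K) ⟩
    ℚ.∣ x n ℚ.- x K ∣ ℚ.+ ℚ.∣ x K ∣
      ≤⟨ ℚ.+-monoˡ-≤ ℚ.∣ x K ∣ (ℚ.<⇒≤ (p n K le ℕ.≤-refl)) ⟩
    1ℚ ℚ.+ ℚ.∣ x K ∣                    ∎
    where
    open ℚ.≤-Reasoning
    split : ∀ a b → a ≡ (a ℚ.- b) ℚ.+ b
    split = solve 2 (λ a b → a := (a :- b) :+ b) refl
      where open +-*-Solver

  scale : ∀ B → Positive B → ∀ ε → .{{Positive ε}} →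
          ∃[ δ ] Positive δ × (∀ a b → ℚ.∣ a ∣ ℚ.≤ B → ℚ.∣ b ∣ ℚ.< δ →
                               ℚ.∣ a ℚ.* b ∣ ℚ.< ε)
  scale B B>0 ε = δ , ℚ.pos*pos⇒pos (ℚ.1/ B) ε , λ a b a≤B b<δ → begin-strict
    ℚ.∣ a ℚ.* b ∣        ≡⟨ ℚ.∣p*q∣≡∣p∣*∣q∣ a b ⟩
    ℚ.∣ a ∣ ℚ.* ℚ.∣ b ∣
      ≤⟨ ℚ.*-monoʳ-≤-nonNeg ℚ.∣ b ∣ {{ℚ.nonNegative (ℚ.0≤∣p∣ b)}} a≤B ⟩
    B ℚ.* ℚ.∣ b ∣        <⟨ ℚ.*-monoʳ-<-pos B b<δ ⟩
    B ℚ.* (ℚ.1/ B ℚ.* ε) ≡⟨ sym (ℚ.*-assoc B (ℚ.1/ B) ε) ⟩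
    (B ℚ.* ℚ.1/ B) ℚ.* ε ≡⟨ cong (ℚ._* ε) (ℚ.*-inverseʳ B) ⟩
    1ℚ ℚ.* ε             ≡⟨ ℚ.*-identityˡ ε ⟩
    ε                    ∎
    where
    open ℚ.≤-Reasoning
    instance
      _ = B>0
      _ = ℚ.pos⇒nonZero B
      _ = ℚ.1/pos⇒pos B
    δ = ℚ.1/ B ℚ.* ε

  *-close : ∀ {ε δ η B D} →
    (∀ a b → ℚ.∣ a ∣ ℚ.≤ B → ℚ.∣ b ∣ ℚ.< δ → ℚ.∣ a ℚ.* b ∣ ℚ.< ½ ℚ.* ε) →
    (∀ a b → ℚ.∣ a ∣ ℚ.≤ D → ℚ.∣ b ∣ ℚ.< η → ℚ.∣ a ℚ.* b ∣ ℚ.< ½ ℚ.* ε) →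
    ∀ a b c d → ℚ.∣ a ∣ ℚ.≤ B → ℚ.∣ d ∣ ℚ.≤ D →
    ℚ.∣ b ℚ.- d ∣ ℚ.< δ → ℚ.∣ a ℚ.- c ∣ ℚ.< η →
    ℚ.∣ a ℚ.* b ℚ.- c ℚ.* d ∣ ℚ.< ε
  *-close {ε} sB sD a b c d a≤B d≤D bd ac = begin-strict
    ℚ.∣ a ℚ.* b ℚ.- c ℚ.* d ∣
      ≡⟨ cong ℚ.∣_∣ (*-rearrange a b c d) ⟩
    ℚ.∣ a ℚ.* (b ℚ.- d) ℚ.+ d ℚ.* (a ℚ.- c) ∣
      ≤⟨ ℚ.∣p+q∣≤∣p∣+∣q∣ (a ℚ.* (b ℚ.- d)) (d ℚ.* (a ℚ.- c)) ⟩
    ℚ.∣ a ℚ.* (b ℚ.- d) ∣ ℚ.+ ℚ.∣ d ℚ.* (a ℚ.- c) ∣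
      <⟨ ℚ.+-mono-< (sB a (b ℚ.- d) a≤B bd) (sD d (a ℚ.- c) d≤D ac) ⟩
    ½ ℚ.* ε ℚ.+ ½ ℚ.* ε
      ≡⟨ half+half ε ⟩
    ε ∎
    where open ℚ.≤-Reasoning

  combine : ∀ {P : ℕ → ℕ → Set} K₁ K₂ K₃ K₄ →
    (∀ m n → K₁ ℕ.≤ m → K₂ ℕ.≤ n → K₃ ℕ.≤ m → K₃ ℕ.≤ n →
             K₄ ℕ.≤ m → K₄ ℕ.≤ n → P m n) →
    ∃[ K ] ∀ m n → K ℕ.≤ m → K ℕ.≤ n → P m n
  combine K₁ K₂ K₃ K₄ p = (K₁ ℕ.⊔ K₂) ℕ.⊔ (K₃ ℕ.⊔ K₄) , λ m n le le′ →
    p m n (ℕ.m⊔n≤o⇒m≤o K₁ K₂ (lo le)) (ℕ.m⊔n≤o⇒n≤o K₁ K₂ (lo le′))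
          (ℕ.m⊔n≤o⇒m≤o K₃ K₄ (hi le)) (ℕ.m⊔n≤o⇒m≤o K₃ K₄ (hi le′))
          (ℕ.m⊔n≤o⇒n≤o K₃ K₄ (hi le)) (ℕ.m⊔n≤o⇒n≤o K₃ K₄ (hi le′))
    where
    lo : ∀ {k} → (K₁ ℕ.⊔ K₂) ℕ.⊔ (K₃ ℕ.⊔ K₄) ℕ.≤ k → K₁ ℕ.⊔ K₂ ℕ.≤ k
    lo = ℕ.m⊔n≤o⇒m≤o (K₁ ℕ.⊔ K₂) (K₃ ℕ.⊔ K₄)
    hi : ∀ {k} → (K₁ ℕ.⊔ K₂) ℕ.⊔ (K₃ ℕ.⊔ K₄) ℕ.≤ k → K₃ ℕ.⊔ K₄ ℕ.≤ k
    hi = ℕ.m⊔n≤o⇒n≤o (K₁ ℕ.⊔ K₂) (K₃ ℕ.⊔ K₄)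

  -- Abstract only so that the proofs are not unfolded during type checking.
  abstract
    +-cauchy : ∀ {x y} → Cauchy x → Cauchy y → Cauchy (λ n → x n ℚ.+ y n)
    +-cauchy {x} {y} cx cy ε
      with cx (½ ℚ.* ε) {{half-pos ε}} | cy (½ ℚ.* ε) {{half-pos ε}}
    ... | K , p | L , q = K ℕ.⊔ L , λ m n le le′ → begin-strict
      ℚ.∣ (x m ℚ.+ y m) ℚ.- (x n ℚ.+ y n) ∣
        ≡⟨ cong ℚ.∣_∣ (+-rearrange (x m) (y m) (x n) (y n)) ⟩
      ℚ.∣ (x m ℚ.- x n) ℚ.+ (y m ℚ.- y n) ∣
        ≤⟨ ℚ.∣p+q∣≤∣p∣+∣q∣ (x m ℚ.- x n) (y m ℚ.- y n) ⟩
      ℚ.∣ x m ℚ.- x n ∣ ℚ.+ ℚ.∣ y m ℚ.- y n ∣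
        <⟨ ℚ.+-mono-< (p m n (ℕ.m⊔n≤o⇒m≤o K L le) (ℕ.m⊔n≤o⇒m≤o K L le′))
                      (q m n (ℕ.m⊔n≤o⇒n≤o K L le) (ℕ.m⊔n≤o⇒n≤o K L le′)) ⟩
      ½ ℚ.* ε ℚ.+ ½ ℚ.* ε
        ≡⟨ half+half ε ⟩
      ε ∎
      where open ℚ.≤-Reasoning

    *-cauchy : ∀ {x y} → Cauchy x → Cauchy y → Cauchy (λ n → x n ℚ.* y n)
    *-cauchy {x} {y} cx cy ε =
      let B , B>0 , K₁ , bx = bounded cx
          D , D>0 , K₂ , by = bounded cy
          δ , δ>0 , sB = scale B B>0 (½ ℚ.* ε) {{half-pos ε}}
          η , η>0 , sD = scale D D>0 (½ ℚ.* ε) {{half-pos ε}}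
          K₃ , py = cy δ {{δ>0}}
          K₄ , px = cx η {{η>0}}
      in combine K₁ K₂ K₃ K₄ λ m n m≥K₁ n≥K₂ m≥K₃ n≥K₃ m≥K₄ n≥K₄ →
        *-close {ε} {δ} {η} {B} {D} sB sD (x m) (y m) (x n) (y n) (bx m m≥K₁) (by n n≥K₂)
                (py m n m≥K₃ n≥K₃) (px m n m≥K₄ n≥K₄)

    const-cauchy : ∀ q → Cauchy (λ _ → q)
    const-cauchy q ε = 0 , λ _ _ _ _ →
      subst (λ z → ℚ.∣ z ∣ ℚ.< ε) (sym (ℚ.+-inverseʳ q)) (ℚ.positive⁻¹ ε)

infixl 6 _+_
infixl 7 _*_

0ℝ : ℝ
0ℝ = mkℝ (λ _ → 0ℚ) (const-cauchy 0ℚ)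

_+_ : ℝ → ℝ → ℝ
x + y = mkℝ (λ n → seq x n ℚ.+ seq y n)
            (+-cauchy {seq x} {seq y} (cauchy x) (cauchy y))

_*_ : ℝ → ℝ → ℝ
x * y = mkℝ (λ n → seq x n ℚ.* seq y n)
            (*-cauchy {seq x} {seq y} (cauchy x) (cauchy y))

sum : ∀ {n} → Vector ℝ n → ℝ
sum = foldr _+_ 0ℝ

Matrix : ℕ → ℕ → Set
Matrix r n = Vector (Vector ℝ n) r

private
  variable
    r n : ℕ

column : Matrix r n → Fin n → Vector ℝ r
column A i k = A k i

_≈ᵛ_ : Vector ℝ r → Vector ℝ r → Set
v ≈ᵛ w = ∀ k → v k ≈ w k

0ᵛ : Vector ℝ r
0ᵛ _ = 0ℝ

_·_ : Vector ℝ r → Vector ℝ r → ℝ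
c · v = sum λ k → c k * v k

-- Σ_{i ∈ S} coeff i · aᵢ; coefficients outside S are ignored.
combination : Matrix r n → Subset n → Vector ℝ n → Vector ℝ r
combination A S coeff k =
  sum λ i → if lookup S i then coeff i * column A i k else 0ℝ

Dependent : Matrix r n → Subset n → Set
Dependent A S = ∃[ coeff ]
  combination A S coeff ≈ᵛ 0ᵛ × (∃[ i ] i ∈ S × coeff i ≉ 0ℝ)

Independent : Matrix r n → Subset n → Set
Independent A S = ¬ Dependent A S

HasRank : Matrix r n → Subset n → ℕ → Set
HasRank A S k =
  (∃[ I ] I ⊆ S × Independent A I × ∣ I ∣ ≡ k) ×
  (∀ {J} → J ⊆ S → Independent A J → ∣ J ∣ ℕ.≤ k)

IsCircuit : Matrix r n → Subset n → Set
IsCircuit A C = Dependent A C × (∀ {D} → D ⊆ C → Dependent A D → D ≡ C)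

record IsSignedCircuit (A : Matrix r n) (C₊ C₋ : Subset n) : Set where
  field
    isCircuit : IsCircuit A (C₊ ∪ C₋)
    disjoint  : Empty (C₊ ∩ C₋)
    coeff     : Vector ℝ n
    positive  : ∀ {i} → i ∈ C₊ ∪ C₋ → coeff i > 0ℝ
    balanced  : combination A C₊ coeff ≈ᵛ combination A C₋ coeff

RankDeficient : Matrix r n → Subset n → Set
RankDeficient {r} A S = ∃[ k ] HasRank A S k × k ℕ.< r

IsCocircuit : Matrix r n → Subset n → Set
IsCocircuit A C₀ =
  RankDeficient A C₀ × (∀ {D} → C₀ ⊆ D → RankDeficient A D → D ≡ C₀)

record IsCocircuitNormal (A : Matrix r n) (C₀ : Subset n) (c : Vector ℝ r) : Set where
  field
    nonzero   : ∃[ k ] c k ≉ 0ℝ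
    vanishing : ∀ i → (c · column A i ≈ 0ℝ) ⇔ (i ∈ C₀)

IsSimplex : Matrix r n → Pred (Subset n) 0ℓ
IsSimplex {r} A S = ∣ S ∣ ≡ r × HasRank A S r

-- F is an (r-1)-subset of S, for a simplex S of a rank r configuration.
IsFacetOf : Matrix r n → Subset n → Subset n → Set
IsFacetOf {r} A F S = F ⊆ S × suc ∣ F ∣ ≡ r

IntersectProperly : Matrix r n → Subset n → Subset n → Set
IntersectProperly A S₁ S₂ =
  ∀ {C₊ C₋} → IsSignedCircuit A C₊ C₋ → ¬ (C₊ ⊆ S₁ × C₋ ⊆ S₂)

IsInterior : Matrix r n → Pred (Subset n) 0ℓ
IsInterior A F = ∃[ C₀ ] IsCocircuit A C₀ × F ⊆ C₀ ×
  ∃[ c ] IsCocircuitNormal A C₀ c ×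
    (∃[ i ] c · column A i > 0ℝ) × (∃[ j ] c · column A j < 0ℝ)

IsInteriorFacet : Matrix r n → Pred (Subset n) 0ℓ
IsInteriorFacet A F = (∃[ S ] IsSimplex A S × IsFacetOf A F S) × IsInterior A F

record IsPartialTriangulation (A : Matrix r n) (Feasible : Pred (Subset n) 0ℓ)
                              (𝒯 : Pred (Subset n) 0ℓ) : Set where
  field
    feasible : 𝒯 U.⊆ Feasible
    proper   : ∀ {S₁ S₂} → 𝒯 S₁ → 𝒯 S₂ → S₁ ≢ S₂ → IntersectProperly A S₁ S₂

record IsTriangulation (A : Matrix r n) (Feasible : Pred (Subset n) 0ℓ)
                       (𝒯 : Pred (Subset n) 0ℓ) : Set where
  field
    nonempty : U.Satisfiable 𝒯
    partial  : IsPartialTriangulation A Feasible 𝒯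
    covering : ∀ {S F} → 𝒯 S → IsFacetOf A F S → IsInterior A F →
               ∃[ S′ ] 𝒯 S′ × S′ ≢ S × F ⊆ S′

IsMin : Fin n → Subset n → Set
IsMin i S = i ∈ S × (∀ {j} → j ∈ S → i Fin.≤ j)

infix 4 _≺_

data _≺_ {n : ℕ} : Subset n → Subset n → Set where
  empty : ∀ {S} → Nonempty S → ⊥ ≺ S
  min<  : ∀ {S R i j} → IsMin i S → IsMin j R → i Fin.< j → S ≺ R
  min≡  : ∀ {S R i} → IsMin i S → IsMin i R → S - i ≺ R - i → S ≺ R

-- The members of P, listed without repetition in increasing lexicographic
-- order; the index set Fin N stands for {1, …, N}.
record LexNumbering {n : ℕ} (P : Pred (Subset n) 0ℓ) (N : ℕ) : Set where
  field
    item       : Fin N → Subset n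
    sound      : ∀ i → P (item i)
    complete   : ∀ {S} → P S → ∃[ i ] item i ≡ S
    increasing : ∀ {i j} → i Fin.< j → item i ≺ item j

module Enumeration
  (A : Matrix r n) (Feasible : Pred (Subset n) 0ℓ) {N M : ℕ}
  (simplices : LexNumbering Feasible N)
  (facets : LexNumbering (IsInteriorFacet A) M)
  where

  simplex : Fin N → Subset n
  simplex = LexNumbering.item simplices

  facet : Fin M → Subset n
  facet = LexNumbering.item facets

  indexed : Subset N → Pred (Subset n) 0ℓ
  indexed T S = ∃[ s ] s ∈ T × simplex s ≡ S

  intfacets : Fin N → Pred (Fin M) 0ℓ
  intfacets s f = IsFacetOf A (facet f) (simplex s)

  adm : Subset N → Pred (Fin N) 0ℓ
  adm T s = ∀ {s′} → s′ ∈ T →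
            s Fin.> s′ × IntersectProperly A (simplex s) (simplex s′)

  free : Subset N → Pred (Fin M) 0ℓ
  free T f = ∃! _≡_ λ s → s ∈ T × intfacets s f

  RightExtendable : Subset N → Set
  RightExtendable T = ∃[ T′ ] T ⊆ T′ ×
    IsTriangulation A Feasible (indexed T′) ×
    (∀ {s′ s} → s′ ∈ T′ → s′ ∉ T → s ∈ T → s′ Fin.> s)

{-# OPTIONS --safe #-}
module Submission where

open import Defs
open import Data.Empty using (⊥-elim)
open import Data.Fin.Base using (Fin)
open import Data.Fin.Properties using (_≟_; ≤-antisym; <-irrefl; <-cmp)
open import Data.Fin.Subset using (Subset; _∈_; _∉_; ⊤; Nonempty)
open import Data.Fin.Subset.Properties using (_∈?_; _⊆?_; ∉⊥)
open import Data.Nat.Base using (ℕ)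
import Data.Nat.Properties as ℕ
open import Data.Product.Base using (∃-syntax; Σ-syntax; _×_; _,_; proj₁; proj₂)
open import Data.Sum.Base using (_⊎_; inj₁; inj₂)
open import Data.Vec.Base using (tabulate)
open import Data.Vec.Properties using (lookup⇒[]=; []=⇒lookup; lookup∘tabulate)
open import Level using (0ℓ)
open import Relation.Binary.Definitions using (tri<; tri≈; tri>)
open import Relation.Binary.PropositionalEquality
  using (_≡_; _≢_; refl; sym; trans; cong; subst)
open import Relation.Nullary.Decidable
  using (Dec; yes; no; does; proof; dec-true; _×-dec_; ¬?)
open import Relation.Nullary.Reflects using (Reflects; invert)
open import Relation.Unary using (Pred; Decidable) renaming (_⊆_ to _⊆ₚ_; _∈_ to _∈ₚ_)

-- The covering simplices of a free facet f are the new simplices T′ \ T of a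
-- right extension T′ that contain f. There is one, since f lies in only one
-- simplex of T and T′ is covering; they are admissible since they are larger
-- than every element of T; and (i) holds because all members of T′ intersect
-- pairwise properly.

private
  variable
    n : ℕ

module _ {P : Pred (Fin n) 0ℓ} (P? : Decidable P) where

  -- A `Subset` is a vector of Booleans, so a property of indices has to be decidable before it can
  -- serve as a covering set `C f`.
  comprehension : Subset n
  comprehension = tabulate λ i → does (P? i)

  ∈-comprehension⁺ : ∀ {i} → P i → i ∈ comprehension
  ∈-comprehension⁺ {i} p =
    lookup⇒[]= i _ (trans (lookup∘tabulate _ i) (dec-true (P? i) p))

  ∈-comprehension⁻ : ∀ {i} → i ∈ comprehension → P i
  ∈-comprehension⁻ {i} i∈ = invert (subst (Reflects (P i))
    (trans (sym (lookup∘tabulate _ i)) ([]=⇒lookup i∈)) (proof (P? i)))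

-- If both sides coincide, `empty` would need an element of the empty set, `min<` would give one set
-- two different minima, and `min≡` leads to the same situation with the minimum removed.
≺⇒≢ : {S R : Subset n} → S ≺ R → S ≢ R
≺⇒≢ (empty (_ , i∈⊥)) refl = ∉⊥ i∈⊥
≺⇒≢ (min< (i∈S , i≤) (j∈S , j≤) i<j) refl =
  <-irrefl (≤-antisym (i≤ j∈S) (j≤ i∈S)) i<j
≺⇒≢ (min≡ _ _ rest) refl = ≺⇒≢ rest refl

-- Two distinct indices are comparable, and the items then differ strictly in lexicographic order.
-- This lets properness, stated for distinct vertex sets, be applied to distinct indices.
item-injective : ∀ {P : Pred (Subset n) 0ℓ} {N} (num : LexNumbering P N) →
  let open LexNumbering num in ∀ {i j} → item i ≡ item j → i ≡ j
item-injective num {i} {j} eq with <-cmp i j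
... | tri< i<j _ _ = ⊥-elim (≺⇒≢ (LexNumbering.increasing num i<j) eq)
... | tri≈ _ i≡j _ = i≡j
... | tri> _ _ j<i = ⊥-elim (≺⇒≢ (LexNumbering.increasing num j<i) (sym eq))

IsFacetOf? : ∀ {r} (A : Matrix r n) F S → Dec (IsFacetOf A F S)
IsFacetOf? A F S = F ⊆? S ×-dec _ ℕ.≟ _

theorem12 : ∀ {r n : ℕ} (A : Matrix r n) → HasRank A ⊤ r →
    (Feasible : Pred (Subset n) 0ℓ) → Feasible ⊆ₚ IsSimplex A →
    {N M : ℕ}
    (simplices : LexNumbering Feasible N)
    (facets : LexNumbering (IsInteriorFacet A) M) →
    let open Enumeration A Feasible simplices facets in
    (T : Subset N) → Nonempty T →
    IsPartialTriangulation A Feasible (indexed T) →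
    RightExtendable T →
    Σ[ C ∈ (Fin M → Subset N) ]
    (∀ f → f ∈ₚ free T → (_∈ C f) ⊆ₚ adm T) ×
    (∀ f → f ∈ₚ free T →
    ∃[ s ] s ∈ C f ×
    (∀ f′ → f′ ∈ₚ free T →
    ∃[ s′ ] s′ ∈ C f′ ×
    (s ≡ s′ ⊎ IntersectProperly A (simplex s) (simplex s′)))) ×
    (∀ f → f ∈ₚ free T → ∀ s → s ∈ C f → f ∈ₚ intfacets s)
theorem12 A _ Feasible _ {N} {M} simplices facets T _ _
  (T′ , T⊆T′ , triangulation , new>old) =
    (λ f → comprehension (Covers? f))
  , (λ f _ s∈C → covers⇒adm (∈-comprehension⁻ (Covers? f) s∈C))
  , (λ f f-free →
      -- The choice of `s` does not depend on `f′`: any two simplices chosen this way lie in `T′`.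
      let s , s-covers = covering-simplex f f-free
      in s , ∈-comprehension⁺ (Covers? f) s-covers , λ f′ f′-free →
        let s′ , s′-covers = covering-simplex f′ f′-free
        in s′ , ∈-comprehension⁺ (Covers? f′) s′-covers
         , ≡⊎proper (proj₁ s-covers) (proj₁ s′-covers))
  , λ f _ _ s∈C → proj₂ (proj₂ (∈-comprehension⁻ (Covers? f) s∈C))
  where
  open Enumeration A Feasible simplices facets
  open IsTriangulation triangulation
  open IsPartialTriangulation partial

  Covers : Fin M → Pred (Fin N) 0ℓ
  Covers f s = s ∈ T′ × s ∉ T × intfacets s f

  Covers? : ∀ f → Decidable (Covers f)
  Covers? f s = s ∈? T′ ×-dec ¬? (s ∈? T) ×-dec IsFacetOf? A (facet f) (simplex s)

  proper′ : ∀ {s s′} → s ∈ T′ → s′ ∈ T′ → s ≢ s′ →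
            IntersectProperly A (simplex s) (simplex s′)
  proper′ {s} {s′} s∈ s′∈ s≢s′ = proper (s , s∈ , refl) (s′ , s′∈ , refl)
    λ eq → s≢s′ (item-injective simplices eq)

  ≡⊎proper : ∀ {s s′} → s ∈ T′ → s′ ∈ T′ →
             s ≡ s′ ⊎ IntersectProperly A (simplex s) (simplex s′)
  ≡⊎proper {s} {s′} s∈ s′∈ with s ≟ s′
  ... | yes s≡s′ = inj₁ s≡s′
  ... | no  s≢s′ = inj₂ (proper′ s∈ s′∈ s≢s′)

  covers⇒adm : ∀ {f s} → Covers f s → adm T s
  covers⇒adm (s∈T′ , s∉T , _) s′∈T =
      new>old s∈T′ s∉T s′∈T
    -- The two indices differ because only `s′` belongs to `T`.
    , proper′ s∈T′ (T⊆T′ s′∈T) λ { refl → s∉T s′∈T }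

  covering-simplex : ∀ f → f ∈ₚ free T → ∃[ s ] Covers f s
  covering-simplex f (s₀ , (s₀∈T , f-facet@(_ , size)) , unique)
    with covering (s₀ , T⊆T′ s₀∈T , refl) f-facet
                  (proj₂ (LexNumbering.sound facets f))
  ... | _ , (s , s∈T′ , refl) , s≢s₀ , f⊆s =
    -- If `s` were in `T`, it would be a second simplex of `T` with facet `f`, against uniqueness of
    -- `s₀`. Covering yields only the inclusion `f⊆s`; the cardinality condition concerns `f` alone,
    -- so `size` carries over from `s₀`.
    s , s∈T′ , (λ s∈T → s≢s₀ (cong simplex (sym (unique (s∈T , f⊆s , size)))))
      , f⊆s , size
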